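{- For any Boolean function $f:\{0,1\}^n\to\{0,1\}$ and any Boolean circuit $C$ over the basis $\{\land_2,\lor_2,\lnot\}$ computing $f$, $\mathsf{EC}(C)\ge \mathsf{psens}(f)/3$.
   Context: A Boolean circuit $C$ over the basis $\{\land_2,\lor_2,\lnot\}$ (AND and OR of fan-in 2, and NOT) is a directed acyclic graph with a root node of out-degree zero, input gates (in-degree zero) labeled by variables $x_1,\dots,x_n$, and non-input gates (including the root, so the root is never an input gate) labeled by functions in the basis; gates may have arbitrary fan-out. For $a\in\{0,1\}^n$, $\mathsf{EC}(C,a)$ is the number of non-input gates of $C$ that output $1$ on $a$, and $\mathsf{EC}(C)=\max_{a\in\{0,1\}^n}\mathsf{EC}(C,a)$. For $a\in\{0,1\}^n$, $a\oplus e_i$ is $a$ with the $i$-th bit flipped. The positive sensitivity of $f$ on $a$, $\mathsf{psens}(f,a)$, is the number of $i\in\{1,\dots,n\}$ such that $a_i=1$ and $f(a\oplus e_i)\ne f(a)$; $\mathsf{psens}(f)=\max_{a\in\{0,1\}^n}\mathsf{psens}(f,a)$. -}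

module Defs where

open import Data.Bool using (Bool; true; false; not; _∧_; _∨_)
import Data.Bool.Properties as Bool
open import Data.Fin using (Fin)
open import Data.Fin.Induction using (spo-wellFounded)
open import Data.List using (List; []; _∷_; [_]; length; map; filter; allFin; cartesianProductWith)
open import Data.List.Extrema.Nat using (max)
open import Data.List.Membership.Propositional using (_∈_)
open import Data.List.Membership.Propositional.Properties using (∈-cartesianProductWith⁺)
open import Data.List.Relation.Unary.Any using (here; there)
open import Data.Nat using (ℕ; zero; suc)
open import Data.Product using (_×_)
open import Data.Vec using (Vec; []; _∷_; lookup; _[_]%=_)
open import Induction.WellFounded using (WellFounded; module All)
open import Level using (0ℓ)
open import Relation.Binary.Construct.Closure.Transitive
  using (TransClosure; _++_; wellFounded⁻)
open import Relation.Binary.PropositionalEquality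
  using (_≡_; _≢_; refl; isEquivalence; resp₂)
open import Relation.Nullary using (Dec; yes; no; ¬_)
open import Relation.Nullary.Decidable using (_×-dec_; ¬?)

Cube : ℕ → Set
Cube n = Vec Bool n

BoolFun : ℕ → Set
BoolFun n = Cube n → Bool

bits : List Bool
bits = true ∷ false ∷ []

cube : ∀ n → List (Cube n)
cube zero    = [ [] ]
cube (suc n) = cartesianProductWith _∷_ bits (cube n)

∈-bits : ∀ b → b ∈ bits
∈-bits true  = here refl
∈-bits false = there (here refl)

∈-cube : ∀ {n} (a : Cube n) → a ∈ cube n
∈-cube []      = here refl
∈-cube (b ∷ a) = ∈-cartesianProductWith⁺ _∷_ (∈-bits b) (∈-cube a)

-- The cube is nonempty, so the default value 0 does not affect the maximum.
maxOverCube : ∀ {n} → (Cube n → ℕ) → ℕ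
maxOverCube {n} φ = max 0 (map φ (cube n))

infixl 6 _⊕e_
_⊕e_ : ∀ {n} → Cube n → Fin n → Cube n
a ⊕e i = a [ i ]%= not

PosSensitive : ∀ {n} → BoolFun n → Cube n → Fin n → Set
PosSensitive f a i = lookup a i ≡ true × f (a ⊕e i) ≢ f a

posSensitive? : ∀ {n} (f : BoolFun n) (a : Cube n) (i : Fin n) → Dec (PosSensitive f a i)
posSensitive? f a i = (lookup a i Bool.≟ true) ×-dec ¬? (f (a ⊕e i) Bool.≟ f a)

psensAt : ∀ {n} → BoolFun n → Cube n → ℕ
psensAt {n} f a = length (filter (posSensitive? f a) (allFin n))

psens : ∀ {n} → BoolFun n → ℕ
psens f = maxOverCube (psensAt f)

-- A node's label together with the nodes its in-edges come from.
data Gate (n : ℕ) (Node : Set) : Set where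
  INPUT : Fin n → Gate n Node
  AND   : Node → Node → Gate n Node
  OR    : Node → Node → Gate n Node
  NOT   : Node → Gate n Node

data NonInput {n : ℕ} {Node : Set} : Gate n Node → Set where
  isAND : ∀ {u v} → NonInput (AND u v)
  isOR  : ∀ {u v} → NonInput (OR u v)
  isNOT : ∀ {u} → NonInput (NOT u)

nonInput? : ∀ {n Node} (g : Gate n Node) → Dec (NonInput g)
nonInput? (INPUT _) = no λ ()
nonInput? (AND _ _) = yes isAND
nonInput? (OR _ _)  = yes isOR
nonInput? (NOT _)   = yes isNOT

data Feeds {n : ℕ} {Node : Set} : Node → Gate n Node → Set where
  andˡ : ∀ {u v} → Feeds u (AND u v)
  andʳ : ∀ {u v} → Feeds v (AND u v)
  orˡ  : ∀ {u v} → Feeds u (OR u v)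
  orʳ  : ∀ {u v} → Feeds v (OR u v)
  not₁ : ∀ {u} → Feeds u (NOT u)

evalGate : ∀ {n Node} → Cube n → (g : Gate n Node) → (∀ {u} → Feeds u g → Bool) → Bool
evalGate a (INPUT i) _   = lookup a i
evalGate a (AND _ _) val = val andˡ ∧ val andʳ
evalGate a (OR _ _)  val = val orˡ ∨ val orʳ
evalGate a (NOT _)   val = not (val not₁)

record Circuit (n : ℕ) : Set where
  field
    size : ℕ
    gate : Fin size → Gate n (Fin size)

  infix 4 _⟶_
  _⟶_ : Fin size → Fin size → Set
  u ⟶ v = Feeds u (gate v)

  field
    acyclic       : ∀ v → ¬ TransClosure _⟶_ v v
    root          : Fin size
    root-sink     : ∀ v → ¬ (root ⟶ v)
    root-nonInput : NonInput (gate root)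

  ⟶-wellFounded : WellFounded _⟶_
  ⟶-wellFounded = wellFounded⁻ _⟶_ (spo-wellFounded record
    { isEquivalence = isEquivalence
    ; irrefl        = λ { refl → acyclic _ }
    ; trans         = _++_
    ; <-resp-≈      = resp₂ (TransClosure _⟶_)
    })

  value : Cube n → Fin size → Bool
  value a = All.wfRec ⟶-wellFounded 0ℓ (λ _ → Bool) (λ v → evalGate a (gate v))

open Circuit

Computes : ∀ {n} → Circuit n → BoolFun n → Set
Computes C f = ∀ a → value C a (root C) ≡ f a

Fires : ∀ {n} (C : Circuit n) → Cube n → Fin (size C) → Set
Fires C a v = NonInput (gate C v) × value C a v ≡ true

fires? : ∀ {n} (C : Circuit n) (a : Cube n) (v : Fin (size C)) → Dec (Fires C a v)
fires? C a v = nonInput? (gate C v) ×-dec (value C a v Bool.≟ true)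

ECAt : ∀ {n} → Circuit n → Cube n → ℕ
ECAt C a = length (filter (fires? C a) (allFin (size C)))

EC : ∀ {n} → Circuit n → ℕ
EC C = maxOverCube (ECAt C)

{-# OPTIONS --safe #-}

-- Let a maximise the positive sensitivity. Flipping x_i from 1 to 0 can only change the
-- root if some gate reading x_i directly either is a NOT gate, or is an AND or OR gate
-- outputting 1 at a: an AND gate outputting 0 keeps doing so when an operand drops.
-- AND and OR gates read at most two variables, so the second case covers at most
-- 2 EC(C,a) indices. The NOT gates on variables all fire at the all-zero input, so
-- the first case covers at most EC(C,0) indices. Hence psens(f,a) ≤ 3 EC(C).
module Submission where

open import Defs
open import Data.Bool using (Bool; true; false; not; _∧_; _∨_; _≤_; f≤t; b≤b)
open import Data.Bool.Properties using (∧-zeroʳ; ∨-zeroʳ; ¬-not; ≤-reflexive)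
open import Data.Fin using (Fin; _≟_)
open import Data.Integer using (+_)
import Data.Integer as ℤ
import Data.Integer.Properties as ℤ
open import Data.List using (List; []; _∷_; [_]; _++_; length; map; filter; allFin; concatMap)
open import Data.List.Extrema.Nat using (xs≤max; max≤v⁺)
open import Data.List.Membership.DecPropositional using (_∈?_)
open import Data.List.Membership.Propositional using (_∈_; _∉_; lose)
open import Data.List.Membership.Propositional.Properties
  using (∈-∃++; ∈-map⁺; ∈-filter⁺; ∈-filter⁻; ∈-allFin; ∈-concatMap⁺; ∈-++⁺ˡ; ∈-++⁺ʳ)
open import Data.List.Properties using (length-++)
open import Data.List.Relation.Binary.Permutation.Propositional.Properties
  using (shift; ↭-length; ∈-resp-↭)
open import Data.List.Relation.Binary.Subset.Propositional using (_⊆_)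
open import Data.List.Relation.Unary.All using (lookup; tabulate)
import Data.List.Relation.Unary.All.Properties as All
open import Data.List.Relation.Unary.AllPairs using ([]; _∷_)
open import Data.List.Relation.Unary.Any using (here; there)
open import Data.List.Relation.Unary.Unique.Propositional using (Unique)
open import Data.List.Relation.Unary.Unique.Propositional.Properties using (allFin⁺; filter⁺)
open import Data.Nat using (ℕ; suc; _+_; _*_; z≤n; s≤s) renaming (_≤_ to _≤ⁿ_)
import Data.Nat.Properties as ℕ
open import Data.Product using (_,_; proj₂)
open import Data.Rational using (_/_; _≥_)
import Data.Rational.Properties as ℚ
open import Data.Rational.Unnormalised using (mkℚᵘ; *≤*)
import Data.Rational.Unnormalised.Properties as ℚᵘ
open import Data.Sum using (_⊎_; inj₁; inj₂)
import Data.Vec as Vec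
open import Data.Vec.Properties
  using (lookup∘updateAt; lookup∘updateAt′; lookup-replicate)
open import Function using (_∘_)
open import Induction.WellFounded using (module All; module FixPoint)
open import Level using (0ℓ)
open import Relation.Binary.PropositionalEquality
  using (_≡_; _≢_; refl; sym; trans; cong; cong₂; subst; subst₂)
open import Relation.Nullary using (yes; no; contradiction)

open Circuit

-- Counting in lists and maxima over the cube.

private
  variable
    A B : Set
    n : ℕ

-- Induction on `xs`: one occurrence of the head `x` is cut out of `ys`, and since `x` does not
-- recur in `xs`, the tail still fits in what remains.
Unique-⊆⇒length≤ : {xs ys : List A} → Unique xs → xs ⊆ ys → length xs ≤ⁿ length ys
Unique-⊆⇒length≤ [] _ = z≤n
Unique-⊆⇒length≤ {xs = x ∷ xs} (x∉xs ∷ xs!) xs⊆ys with ∈-∃++ (xs⊆ys (here refl))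
... | as , bs , refl = begin
  suc (length xs)         ≤⟨ s≤s (Unique-⊆⇒length≤ xs! xs⊆as++bs) ⟩
  suc (length (as ++ bs)) ≡⟨ ↭-length (shift x as bs) ⟨
  length (as ++ x ∷ bs)   ∎
  where
  open ℕ.≤-Reasoning
  xs⊆as++bs : xs ⊆ as ++ bs
  xs⊆as++bs y∈xs with ∈-resp-↭ (shift x as bs) (xs⊆ys (there y∈xs))
  ... | here refl = contradiction refl (lookup x∉xs y∈xs)
  ... | there y∈  = y∈

length-concatMap≤ : ∀ k (h : A → List B) → (∀ x → length (h x) ≤ⁿ k) →
                    ∀ xs → length (concatMap h xs) ≤ⁿ length xs * k
length-concatMap≤ k h h≤k []       = z≤n
length-concatMap≤ k h h≤k (x ∷ xs) = begin
  length (h x ++ concatMap h xs)         ≡⟨ length-++ (h x) ⟩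
  length (h x) + length (concatMap h xs) ≤⟨ ℕ.+-mono-≤ (h≤k x) (length-concatMap≤ k h h≤k xs) ⟩
  k + length xs * k                      ∎
  where open ℕ.≤-Reasoning

≤-maxOverCube : (φ : Cube n → ℕ) (a : Cube n) → φ a ≤ⁿ maxOverCube φ
≤-maxOverCube {n} φ a = lookup (xs≤max 0 (map φ (cube n))) (∈-map⁺ φ (∈-cube a))

maxOverCube-≤ : (φ : Cube n → ℕ) {m : ℕ} → (∀ a → φ a ≤ⁿ m) → maxOverCube φ ≤ⁿ m
maxOverCube-≤ {n} φ φ≤m = max≤v⁺ z≤n (All.map⁺ (tabulate {xs = cube n} λ {a} _ → φ≤m a))

-- Single gates: stability, congruence, variables read.

∧-stable : ∀ {x x′ y y′} → x′ ≤ x → y′ ≤ y →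
           (x′ ≢ x → x ∧ y ≡ false) → (y′ ≢ y → x ∧ y ≡ false) → x′ ∧ y′ ≡ x ∧ y
∧-stable         b≤b b≤b _ _ = refl
∧-stable         f≤t _   h _ = sym (h λ ())
∧-stable {x = x} b≤b f≤t _ h = trans (∧-zeroʳ x) (sym (h λ ()))

-- An operand that drops was 1, so the disjunction was 1, against the hypothesis for that operand.
-- Hence neither operand changes.
∨-stable : ∀ {x x′ y y′} → x′ ≤ x → y′ ≤ y →
           (x′ ≢ x → x ∨ y ≡ false) → (y′ ≢ y → x ∨ y ≡ false) → x′ ∨ y′ ≡ x ∨ y
∨-stable         b≤b b≤b _ _ = refl
∨-stable         f≤t _   h _ = contradiction (h λ ()) λ ()
∨-stable {x = x} b≤b f≤t _ h = contradiction (trans (sym (∨-zeroʳ x)) (h λ ())) λ ()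

-- The extensionality condition under which the well-founded recursion defining `value` unfolds.
evalGate-cong : ∀ {Node} (a : Cube n) (g : Gate n Node) {val val′ : ∀ {u} → Feeds u g → Bool} →
                (∀ {u} (e : Feeds u g) → val e ≡ val′ e) → evalGate a g val ≡ evalGate a g val′
evalGate-cong a (INPUT _) eq = refl
evalGate-cong a (AND _ _) eq = cong₂ _∧_ (eq andˡ) (eq andʳ)
evalGate-cong a (OR _ _)  eq = cong₂ _∨_ (eq orˡ) (eq orʳ)
evalGate-cong a (NOT _)   eq = cong not (eq not₁)

inputVar : ∀ {Node} → Gate n Node → List (Fin n)
inputVar (INPUT i) = [ i ]
inputVar _         = []

∈-inputVar : ∀ {Node} {g : Gate n Node} {i} → g ≡ INPUT i → i ∈ inputVar g
∈-inputVar refl = here refl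

length-inputVar : ∀ {Node} (g : Gate n Node) → length (inputVar g) ≤ⁿ 1
length-inputVar (INPUT _) = ℕ.≤-refl
length-inputVar (AND _ _) = z≤n
length-inputVar (OR _ _)  = z≤n
length-inputVar (NOT _)   = z≤n

zeros : Cube n
zeros = Vec.replicate _ false

module _ {n : ℕ} (C : Circuit n) where

  private
    Node : Set
    Node = Fin (size C)

  -- Taking `g` with an equation, rather than `gate C v` itself, lets later proofs split on `g`
  -- first.
  value-gate : ∀ a {v g} → gate C v ≡ g → value C a v ≡ evalGate a g (λ {u} _ → value C a u)
  value-gate a refl =
    FixPoint.unfold-wfRec (⟶-wellFounded C) (λ _ → Bool) (λ v → evalGate a (gate C v))
      (λ v → evalGate-cong a (gate C v))

  -- The charged variables and their number.

  binaryVars : Gate n Node → List (Fin n)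
  binaryVars (AND u v) = inputVar (gate C u) ++ inputVar (gate C v)
  binaryVars (OR u v)  = inputVar (gate C u) ++ inputVar (gate C v)
  binaryVars _         = []

  negatedVar : Gate n Node → List (Fin n)
  negatedVar (NOT u) = inputVar (gate C u)
  negatedVar _       = []

  length-binaryVars : ∀ g → length (binaryVars g) ≤ⁿ 2
  length-binaryVars (INPUT _) = z≤n
  length-binaryVars (NOT _)   = z≤n
  length-binaryVars (AND u v) = begin
    length (inputVar (gate C u) ++ inputVar (gate C v)) ≡⟨ length-++ (inputVar (gate C u)) ⟩
    length (inputVar (gate C u)) + length (inputVar (gate C v))
      ≤⟨ ℕ.+-mono-≤ (length-inputVar (gate C u)) (length-inputVar (gate C v)) ⟩
    2 ∎
    where open ℕ.≤-Reasoning
  length-binaryVars (OR u v) = length-binaryVars (AND u v)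

  length-negatedVar : ∀ g → length (negatedVar g) ≤ⁿ 1
  length-negatedVar (INPUT _) = z≤n
  length-negatedVar (AND _ _) = z≤n
  length-negatedVar (OR _ _)  = z≤n
  length-negatedVar (NOT u)   = length-inputVar (gate C u)

  firing : Cube n → List Node
  firing a = filter (fires? C a) (allFin (size C))

  -- Repetitions are harmless, as only an upper bound on the length is needed. The two halves use
  -- different inputs, so each is bounded by `EC C` separately.
  chargedVars : Cube n → List (Fin n)
  chargedVars a = concatMap (binaryVars ∘ gate C) (firing a)
               ++ concatMap (negatedVar ∘ gate C) (firing zeros)

  length-chargedVars : ∀ a → length (chargedVars a) ≤ⁿ 3 * EC C
  length-chargedVars a = begin
    length (chargedVars a)
      ≡⟨ length-++ (concatMap (binaryVars ∘ gate C) (firing a)) ⟩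
    length (concatMap (binaryVars ∘ gate C) (firing a))
      + length (concatMap (negatedVar ∘ gate C) (firing zeros))
      ≤⟨ ℕ.+-mono-≤
           (length-concatMap≤ 2 _ (length-binaryVars ∘ gate C) (firing a))
           (length-concatMap≤ 1 _ (length-negatedVar ∘ gate C) (firing zeros)) ⟩
    ECAt C a * 2 + ECAt C zeros * 1
      ≤⟨ ℕ.+-mono-≤ (ℕ.*-monoˡ-≤ 2 (≤-maxOverCube (ECAt C) a))
                    (ℕ.*-monoˡ-≤ 1 (≤-maxOverCube (ECAt C) zeros)) ⟩
    EC C * 2 + EC C * 1 ≡⟨ ℕ.*-distribˡ-+ (EC C) 2 1 ⟨
    EC C * 3            ≡⟨ ℕ.*-comm (EC C) 3 ⟩
    3 * EC C            ∎
    where open ℕ.≤-Reasoning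

  -- Flipping an uncharged variable from 1 to 0.

  module _ {a : Cube n} {i : Fin n} (aᵢ : Vec.lookup a i ≡ true) (i∉ : i ∉ chargedVars a) where

    uncharged-binary⇒false : ∀ {v g} → gate C v ≡ g → NonInput g → i ∈ binaryVars g →
                             value C a v ≡ false
    uncharged-binary⇒false {v} refl ni i∈ = ¬-not λ v≡true →
      i∉ (∈-++⁺ˡ (∈-concatMap⁺ (binaryVars ∘ gate C)
        (lose (∈-filter⁺ (fires? C a) (∈-allFin v) (ni , v≡true)) i∈)))

    -- A NOT gate reading the variable directly would output 1 on `zeros`, and so charge `i`.
    uncharged-not : ∀ {v u} → gate C v ≡ NOT u → gate C u ≢ INPUT i
    uncharged-not {v} {u} v≡NOT u≡i =
      i∉ (∈-++⁺ʳ _ (∈-concatMap⁺ (negatedVar ∘ gate C)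
        (lose (∈-filter⁺ (fires? C zeros) (∈-allFin v) (ni , v≡true)) i∈)))
      where
      ni : NonInput (gate C v)
      ni = subst NonInput (sym v≡NOT) isNOT
      i∈ : i ∈ negatedVar (gate C v)
      i∈ = subst (λ g → i ∈ negatedVar g) (sym v≡NOT) (∈-inputVar u≡i)
      v≡true : value C zeros v ≡ true
      v≡true = trans (value-gate zeros v≡NOT)
        (cong not (trans (value-gate zeros u≡i) (lookup-replicate i false)))

    -- The invariant of the induction along wires. Input gates labelled `i` must be exempt, since
    -- they do change.
    Insensitive : Node → Set
    Insensitive v = gate C v ≡ INPUT i ⊎ value C (a ⊕e i) v ≡ value C a v

    insensitive⇒≤ : ∀ {u} → Insensitive u → value C (a ⊕e i) u ≤ value C a u
    insensitive⇒≤ (inj₂ eq) = ≤-reflexive eq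
    insensitive⇒≤ (inj₁ u≡i) = subst₂ _≤_
      (sym (trans (value-gate (a ⊕e i) u≡i) (trans (lookup∘updateAt i a) (cong not aᵢ))))
      (sym (trans (value-gate a u≡i) aᵢ))
      f≤t

    changed⇒inputVar : ∀ {u} → Insensitive u → value C (a ⊕e i) u ≢ value C a u →
                       i ∈ inputVar (gate C u)
    changed⇒inputVar (inj₁ u≡i) _ = ∈-inputVar u≡i
    changed⇒inputVar (inj₂ eq)  ≢ = contradiction eq ≢

    -- An operand can change only if it is the variable `i` itself, and then it drops. A binary gate
    -- with such an operand is uncharged, hence outputs 0 at `a`, and monotonicity keeps it there.
    evalGate-⊕e : ∀ {v g} → gate C v ≡ g → (∀ {u} → Feeds u g → Insensitive u) → g ≢ INPUT i →
                  evalGate (a ⊕e i) g (λ {u} _ → value C (a ⊕e i) u)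
                    ≡ evalGate a g (λ {u} _ → value C a u)
    evalGate-⊕e {g = INPUT j} _ _ g≢i =
      lookup∘updateAt′ j i (λ j≡i → g≢i (cong INPUT j≡i)) a
    evalGate-⊕e {g = AND u w} v≡g ih _ =
      ∧-stable (insensitive⇒≤ (ih andˡ)) (insensitive⇒≤ (ih andʳ))
        (λ ≢ → silent (∈-++⁺ˡ (changed⇒inputVar (ih andˡ) ≢)))
        (λ ≢ → silent (∈-++⁺ʳ (inputVar (gate C u)) (changed⇒inputVar (ih andʳ) ≢)))
      where
      silent : i ∈ binaryVars (AND u w) → value C a u ∧ value C a w ≡ false
      silent i∈ = trans (sym (value-gate a v≡g)) (uncharged-binary⇒false v≡g isAND i∈)
    evalGate-⊕e {g = OR u w} v≡g ih _ =
      ∨-stable (insensitive⇒≤ (ih orˡ)) (insensitive⇒≤ (ih orʳ))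
        (λ ≢ → silent (∈-++⁺ˡ (changed⇒inputVar (ih orˡ) ≢)))
        (λ ≢ → silent (∈-++⁺ʳ (inputVar (gate C u)) (changed⇒inputVar (ih orʳ) ≢)))
      where
      silent : i ∈ binaryVars (OR u w) → value C a u ∨ value C a w ≡ false
      silent i∈ = trans (sym (value-gate a v≡g)) (uncharged-binary⇒false v≡g isOR i∈)
    -- Negation is not monotone, so a changed operand has to be excluded outright.
    evalGate-⊕e {g = NOT u} v≡g ih _ with ih not₁
    ... | inj₁ u≡i = contradiction u≡i (uncharged-not v≡g)
    ... | inj₂ eq  = cong not eq

    input? : (g : Gate n Node) → g ≡ INPUT i ⊎ g ≢ INPUT i
    input? (INPUT j) with j ≟ i
    ... | yes refl = inj₁ refl
    ... | no  j≢i  = inj₂ λ { refl → j≢i refl }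
    input? (AND _ _) = inj₂ λ ()
    input? (OR _ _)  = inj₂ λ ()
    input? (NOT _)   = inj₂ λ ()

    insensitive-step : ∀ v → (∀ {u} → Feeds u (gate C v) → Insensitive u) → Insensitive v
    insensitive-step v ih with input? (gate C v)
    ... | inj₁ v≡i = inj₁ v≡i
    ... | inj₂ v≢i = inj₂ (trans (value-gate (a ⊕e i) refl)
                            (trans (evalGate-⊕e refl ih v≢i) (sym (value-gate a refl))))

    insensitive : ∀ v → Insensitive v
    insensitive = All.wfRec (⟶-wellFounded C) 0ℓ Insensitive insensitive-step

    root-insensitive : value C (a ⊕e i) (root C) ≡ value C a (root C)
    root-insensitive with insensitive (root C)
    -- The exempt case cannot occur at the root, which is not an input gate.
    ... | inj₁ root≡i = contradiction (subst NonInput root≡i (root-nonInput C)) λ ()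
    ... | inj₂ eq     = eq

  -- From charged variables to the bound on sensitivity.

  posSensitive⇒charged : ∀ {f a i} → Computes C f → PosSensitive f a i → i ∈ chargedVars a
  posSensitive⇒charged {a = a} {i} C≗f (aᵢ , f≢) with _∈?_ _≟_ i (chargedVars a)
  ... | yes i∈ = i∈
  ... | no  i∉ = contradiction
    (trans (sym (C≗f (a ⊕e i))) (trans (root-insensitive aᵢ i∉) (C≗f a))) f≢

  -- The sensitive indices are listed without repetition and are all charged, so the length of the
  -- charged list bounds their number.
  psensAt≤3EC : ∀ {f} → Computes C f → ∀ a → psensAt f a ≤ⁿ 3 * EC C
  psensAt≤3EC {f} C≗f a = ℕ.≤-trans
    (Unique-⊆⇒length≤ (filter⁺ (posSensitive? f a) (allFin⁺ n))
      (posSensitive⇒charged C≗f ∘ proj₂ ∘ ∈-filter⁻ (posSensitive? f a) {xs = allFin n}))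
    (length-chargedVars a)

p≤3m⇒p/3≤m/1 : ∀ p m → p ≤ⁿ 3 * m → (+ m) / 1 ≥ (+ p) / 3
p≤3m⇒p/3≤m/1 p m p≤3m = ℚ.toℚᵘ-cancel-≤ (begin
  -- Unnormalised fractions compare by cross-multiplication. `mkℚᵘ` stores the denominator minus
  -- one, so 2 and 0 stand for denominators 3 and 1.
  _              ≃⟨ ℚ.toℚᵘ-fromℚᵘ (mkℚᵘ (+ p) 2) ⟩
  mkℚᵘ (+ p) 2   ≤⟨ *≤* (ℤ≤ p≤3m) ⟩
  mkℚᵘ (+ m) 0   ≃⟨ ℚ.toℚᵘ-fromℚᵘ (mkℚᵘ (+ m) 0) ⟨
  _              ∎)
  where
  open ℚᵘ.≤-Reasoning
  ℤ≤ : p ≤ⁿ 3 * m → (+ p) ℤ.* (+ 1) ℤ.≤ (+ m) ℤ.* (+ 3)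
  ℤ≤ h rewrite ℤ.*-identityʳ (+ p) | sym (ℤ.pos-* m 3) | ℕ.*-comm m 3 = ℤ.+≤+ h

theorem1p2 : ∀ (n : ℕ) (f : BoolFun n) (C : Circuit n) →
    Computes C f →
    (+ EC C) / 1 ≥ (+ psens f) / 3
theorem1p2 n f C C≗f =
  p≤3m⇒p/3≤m/1 (psens f) (EC C) (maxOverCube-≤ (psensAt f) (psensAt≤3EC C C≗f))
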